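{- Let $\phi=\frac{1}{2}(1+\sqrt{5})$. The Fibonacci number $F_n$ satisfies $$F_n = \operatorname{Res}_{x} \frac{(1+x)^n}{(x+\phi)(x-1/\phi)},$$ where $\operatorname{Res}_x f(x)$ denotes the sum of the residues of $f(x)$ over all its poles.
   Context: $F_n$ is the Fibonacci number, defined by the Binet formula $F_n=\frac{1}{\sqrt5}(\phi^n-(1-\phi)^n)$, where $\phi=\frac{1}{2}(1+\sqrt5)$ is the golden ratio. For a function $f(x)$ with poles $x_1,\dots,x_N$, $\operatorname{Res}_x f(x)=\sum_{p=1}^{N}\operatorname{Res}_{x=x_p} f(x)$, where the residue of $f$ at a pole $x_p$ of order $k$ is $\operatorname{Res}_{x=x_p} f(x)=\frac{1}{(k-1)!}\frac{d^{k-1}}{dx^{k-1}}\left[(x-x_p)^k f(x)\right]\Big|_{x=x_p}$. -}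

module Defs where

open import Algebra.Apartness.Bundles using (HeytingField; HeytingCommutativeRing)
open import Algebra.Bundles using (CommutativeRing; Semiring)
open import Data.Fin.Base using (Fin)
open import Data.List.Base using (List; []; _∷_; map)
open import Data.Nat.Base as ℕ using (ℕ; zero; suc; _!)
open import Data.Nat.GeneralisedArithmetic using (fold)
open import Data.Nat.Properties using (_!≢0)
open import Data.Product.Base using (∃-syntax; _,_; proj₁; proj₂)
open import Level using (_⊔_)
open import Relation.Binary.PropositionalEquality.Core using (_≢_)
import Algebra.Apartness.Properties.HeytingCommutativeRing as HeytingProperties
import Algebra.Definitions.RawSemiring as RawSemiringDefinitions
import Algebra.Properties.CommutativeSemigroup as CommutativeSemigroupProperties
import Algebra.Properties.Ring as RingProperties
import Relation.Binary.Reasoning.Setoid as ≈-Reasoning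

-- The field K is arbitrary (for instance ℝ or ℂ); apartness _#_ plays the part
-- of "≠", and is just the negation of _≈_ when K is classical.

module Field {c ℓ₁ ℓ₂} (K : HeytingField c ℓ₁ ℓ₂) where

  open HeytingField K public
  open HeytingCommutativeRing heytingCommutativeRing public using (commutativeRing)
  open CommutativeRing commutativeRing public
    using (ring; semiring; *-commutativeSemigroup; +-commutativeSemigroup)
  open Semiring semiring public using (rawSemiring)
  open RawSemiringDefinitions rawSemiring public using (_^_; sum) renaming (_×_ to _·ℕ_)

  fromℕ : ℕ → Carrier
  fromℕ n = n ·ℕ 1#

  inv : ∀ x → x # 0# → Carrier
  inv x x#0 = proj₁ (#⇒invertible x#0)

CharacteristicZero : ∀ {c ℓ₁ ℓ₂} → HeytingField c ℓ₁ ℓ₂ → Set ℓ₂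
CharacteristicZero K = ∀ n .{{_ : ℕ.NonZero n}} → fromℕ n # 0#
  where open Field K

module Apartness {c ℓ₁ ℓ₂} (K : HeytingField c ℓ₁ ℓ₂) where

  open Field K
  open HeytingProperties heytingCommutativeRing public
  open ≈-Reasoning setoid

  xy#0⇒x#0 : ∀ {x y} → x * y # 0# → x # 0#
  xy#0⇒x#0 {x} {y} xy#0 = invertibleʳ⇒# (y * z , (begin
    (x - 0#) * (y * z)  ≈⟨ *-congʳ (x-0≈x x) ⟩
    x * (y * z)         ≈⟨ *-assoc x y z ⟨
    x * y * z           ≈⟨ *-congʳ (x-0≈x (x * y)) ⟨
    (x * y - 0#) * z    ≈⟨ proj₂ (proj₂ (#⇒invertible xy#0)) ⟩
    1#                  ∎))
    where z = inv (x * y) xy#0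

  inv#0 : ∀ {x} (x#0 : x # 0#) → inv x x#0 # 0#
  inv#0 {x} x#0 = xy#0⇒x#0 {y = x - 0#}
    (#-congʳ (sym (proj₁ (proj₂ (#⇒invertible x#0)))) 1#0)

-- Polynomials are lists of coefficients, constant term first; trailing zeros
-- are allowed and are ignored by _≋_.

module Polynomial {c ℓ₁ ℓ₂} (K : HeytingField c ℓ₁ ℓ₂) where

  open Field K

  infix  4 _≋_
  infixl 6 _+ₚ_ _-ₚ_
  infixl 7 _*ₚ_ _·ₚ_
  infixr 8 _^ₚ_

  Poly : Set c
  Poly = List Carrier

  coeff : Poly → ℕ → Carrier
  coeff []      _       = 0#
  coeff (a ∷ p) zero    = a
  coeff (a ∷ p) (suc i) = coeff p i

  _≋_ : Poly → Poly → Set ℓ₁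
  p ≋ q = ∀ i → coeff p i ≈ coeff q i

  NonZeroPoly : Poly → Set ℓ₂
  NonZeroPoly p = ∃[ i ] coeff p i # 0#

  const : Carrier → Poly
  const a = a ∷ []

  X : Poly
  X = 0# ∷ 1# ∷ []

  _+ₚ_ : Poly → Poly → Poly
  []      +ₚ q       = q
  (a ∷ p) +ₚ []      = a ∷ p
  (a ∷ p) +ₚ (b ∷ q) = (a + b) ∷ (p +ₚ q)

  _·ₚ_ : Carrier → Poly → Poly
  a ·ₚ p = map (a *_) p

  _-ₚ_ : Poly → Poly → Poly
  p -ₚ q = p +ₚ map -_ q

  -- (a + X p) q = a q + X (p q)
  _*ₚ_ : Poly → Poly → Poly
  []      *ₚ q = []
  (a ∷ p) *ₚ q = (a ·ₚ q) +ₚ (0# ∷ (p *ₚ q))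

  _^ₚ_ : Poly → ℕ → Poly
  p ^ₚ zero  = const 1#
  p ^ₚ suc n = p *ₚ p ^ₚ n

  -- (a + X p)′ = p + X p′
  derivₚ : Poly → Poly
  derivₚ []      = []
  derivₚ (a ∷ p) = p +ₚ (0# ∷ derivₚ p)

  eval : Poly → Carrier → Carrier
  eval []      x = 0#
  eval (a ∷ p) x = a + x * eval p x

  module _ (x : Carrier) where

    open CommutativeSemigroupProperties +-commutativeSemigroup using (interchange)
    open CommutativeSemigroupProperties *-commutativeSemigroup using (x∙yz≈y∙xz)
    open ≈-Reasoning setoid

    eval-+ₚ : ∀ p q → eval (p +ₚ q) x ≈ eval p x + eval q x
    eval-+ₚ []      q       = sym (+-identityˡ _)
    eval-+ₚ (a ∷ p) []      = sym (+-identityʳ _)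
    eval-+ₚ (a ∷ p) (b ∷ q) = begin
      (a + b) + x * eval (p +ₚ q) x              ≈⟨ +-congˡ (*-congˡ (eval-+ₚ p q)) ⟩
      (a + b) + x * (eval p x + eval q x)        ≈⟨ +-congˡ (distribˡ x _ _) ⟩
      (a + b) + (x * eval p x + x * eval q x)    ≈⟨ interchange a b _ _ ⟩
      (a + x * eval p x) + (b + x * eval q x)    ∎

    eval-·ₚ : ∀ a p → eval (a ·ₚ p) x ≈ a * eval p x
    eval-·ₚ a []      = sym (zeroʳ a)
    eval-·ₚ a (b ∷ p) = begin
      a * b + x * eval (a ·ₚ p) x  ≈⟨ +-congˡ (*-congˡ (eval-·ₚ a p)) ⟩
      a * b + x * (a * eval p x)   ≈⟨ +-congˡ (x∙yz≈y∙xz x a _) ⟩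
      a * b + a * (x * eval p x)   ≈⟨ distribˡ a b _ ⟨
      a * (b + x * eval p x)       ∎

    eval-*ₚ : ∀ p q → eval (p *ₚ q) x ≈ eval p x * eval q x
    eval-*ₚ []      q = sym (zeroˡ _)
    eval-*ₚ (a ∷ p) q = begin
      eval ((a ·ₚ q) +ₚ (0# ∷ (p *ₚ q))) x         ≈⟨ eval-+ₚ (a ·ₚ q) _ ⟩
      eval (a ·ₚ q) x + (0# + x * eval (p *ₚ q) x) ≈⟨ +-cong (eval-·ₚ a q) (+-identityˡ _) ⟩
      a * eval q x + x * eval (p *ₚ q) x           ≈⟨ +-congˡ (*-congˡ (eval-*ₚ p q)) ⟩
      a * eval q x + x * (eval p x * eval q x)     ≈⟨ +-congˡ (*-assoc x _ _) ⟨
      a * eval q x + x * eval p x * eval q x       ≈⟨ distribʳ _ a _ ⟨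
      (a + x * eval p x) * eval q x                ∎

module Residue {c ℓ₁ ℓ₂} (K : HeytingField c ℓ₁ ℓ₂) (char0 : CharacteristicZero K) where

  open Field K
  open Polynomial K
  open Apartness K using (#-congʳ; x#0y#0→xy#0)

  record RationalFunction : Set (c ⊔ ℓ₂) where
    field
      num   : Poly
      den   : Poly
      den#0 : NonZeroPoly den

  -- Fractions that are defined at a, i.e. elements of the local ring of
  -- rational functions at a.
  record RegularAt (a : Carrier) : Set (c ⊔ ℓ₂) where
    field
      num      : Poly
      den      : Poly
      den[a]#0 : eval den a # 0#

  module _ {a : Carrier} where

    open RegularAt

    value : RegularAt a → Carrier
    value g = eval (num g) a * inv (eval (den g) a) (den[a]#0 g)

    deriv : RegularAt a → RegularAt a
    deriv g = record
      { num      = derivₚ (num g) *ₚ den g -ₚ num g *ₚ derivₚ (den g)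
      ; den      = den g *ₚ den g
      ; den[a]#0 = #-congʳ (sym (eval-*ₚ a (den g) (den g)))
                           (x#0y#0→xy#0 (den[a]#0 g) (den[a]#0 g))
      }

  -- f has a pole at a, of order k = suc m: the rational function (x - a)ᵏ f(x)
  -- equals some g (as fractions, by cross-multiplication) which is defined and
  -- nonzero at a.
  record PoleAt (f : RationalFunction) (a : Carrier) : Set (c ⊔ ℓ₁ ⊔ ℓ₂) where
    private
      module f = RationalFunction f
    field
      m : ℕ
      g : RegularAt a
    private
      module g = RegularAt g
    field
      g-spec : ((X -ₚ const a) ^ₚ suc m *ₚ f.num) *ₚ g.den ≋ g.num *ₚ f.den
      g[a]#0 : value g # 0#

  -- 1/(k-1)! times the (k-1)-st derivative of (x - a)ᵏ f(x) at x = a; the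
  -- derivative is the formal one, which for rational functions over ℝ or ℂ is
  -- the analytic one.
  residue : ∀ {f a} → PoleAt f a → Carrier
  residue p = inv (fromℕ (m !)) (char0 (m !) {{m !≢0}}) * value (fold g deriv m)
    where open PoleAt p

  record Poles (f : RationalFunction) : Set (c ⊔ ℓ₁ ⊔ ℓ₂) where
    field
      N        : ℕ
      x        : Fin N → Carrier
      pole     : ∀ p → PoleAt f (x p)
      distinct : ∀ {p q} → p ≢ q → x p # x q
      complete : ∀ {a} → PoleAt f a → ∃[ p ] a ≈ x p

  Res : ∀ {f} → Poles f → Carrier
  Res P = sum (λ p → residue (pole p))
    where open Poles P

-- Either square root of 5 is allowed for √5; over ℝ or ℂ this includes the
-- positive one.

module Golden {c ℓ₁ ℓ₂} (K : HeytingField c ℓ₁ ℓ₂) (char0 : CharacteristicZero K)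
              (√5 : HeytingField.Carrier K)
              (√5²≈5 : HeytingField._≈_ K (HeytingField._*_ K √5 √5) (Field.fromℕ K 5)) where

  open Field K
  open Polynomial K
  open Residue K char0
  open Apartness K

  √5#0 : √5 # 0#
  √5#0 = xy#0⇒x#0 (#-congʳ (sym √5²≈5) (char0 5))

  ½ : Carrier
  ½ = inv (fromℕ 2) (char0 2)

  φ : Carrier
  φ = ½ * (1# + √5)

  private
    open ≈-Reasoning setoid

    [1+√5][√5-1]≈4 : (1# + √5) * (√5 - 1#) ≈ fromℕ 4
    [1+√5][√5-1]≈4 = begin
      (1# + √5) * (√5 - 1#)              ≈⟨ distribʳ _ 1# √5 ⟩
      1# * (√5 - 1#) + √5 * (√5 - 1#)    ≈⟨ +-cong (*-identityˡ _) (distribˡ √5 √5 _) ⟩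
      √5 - 1# + (√5 * √5 + √5 * - 1#)    ≈⟨ +-congˡ (+-cong √5²≈5 √5*-1≈-√5) ⟩
      √5 - 1# + (1# + fromℕ 4 + - √5)    ≈⟨ +-congʳ (+-comm √5 _) ⟩
      - 1# + √5 + (1# + fromℕ 4 + - √5)  ≈⟨ +-congˡ (+-comm _ _) ⟩
      - 1# + √5 + (- √5 + (1# + fromℕ 4)) ≈⟨ +-assoc _ _ _ ⟩
      - 1# + (√5 + (- √5 + (1# + fromℕ 4))) ≈⟨ +-congˡ (+-assoc _ _ _) ⟨
      - 1# + (√5 - √5 + (1# + fromℕ 4))  ≈⟨ +-congˡ (+-congʳ (-‿inverseʳ √5)) ⟩
      - 1# + (0# + (1# + fromℕ 4))       ≈⟨ +-congˡ (+-identityˡ _) ⟩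
      - 1# + (1# + fromℕ 4)              ≈⟨ +-assoc _ _ _ ⟨
      - 1# + 1# + fromℕ 4                ≈⟨ +-congʳ (-‿inverseˡ 1#) ⟩
      0# + fromℕ 4                       ≈⟨ +-identityˡ _ ⟩
      fromℕ 4                            ∎
      where
      open RingProperties ring using (-‿distribʳ-*)
      √5*-1≈-√5 : √5 * - 1# ≈ - √5
      √5*-1≈-√5 = trans (sym (-‿distribʳ-* √5 1#)) (-‿cong (*-identityʳ √5))

  φ#0 : φ # 0#
  φ#0 = x#0y#0→xy#0 (inv#0 (char0 2))
                     (xy#0⇒x#0 (#-congʳ (sym [1+√5][√5-1]≈4) (char0 4)))

  1/φ : Carrier
  1/φ = inv φ φ#0

  -- Binet's formula
  F : ℕ → Carrier
  F n = inv √5 √5#0 * (φ ^ n - (1# - φ) ^ n)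

  -- (1 + x)ⁿ / ((x + φ) (x - 1/φ))
  f : ℕ → RationalFunction
  f n = record
    { num   = (const 1# +ₚ X) ^ₚ n
    ; den   = (X +ₚ const φ) *ₚ (X -ₚ const 1/φ)
    ; den#0 = 2 , #-congʳ (sym (*-identityʳ 1#)) 1#0
    }

{-# OPTIONS --safe #-}
-- At a zero a of the denominator D with D′(a) # 0, differentiating the defining
-- identity (x - a)ᵏ N(x) h(x) = g(x) D(x) of a pole (where (x - a)ᵏ f(x) = g(x)/h(x))
-- at x = a gives [k = 1] N(a) h(a) = g(a) D′(a). As g(a) # 0, the pole is simple,
-- and its residue is N(a)/D′(a). For D = (x + φ)(x - 1/φ) the identity
-- 1/φ = φ - 1 makes D′ equal to √5 at 1/φ and to -√5 at -φ, while 1 + x is φ at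
-- 1/φ and 1 - φ at -φ; the two residues add up to Binet's formula.

module Submission where

open import Defs
open import Algebra.Apartness.Bundles using (HeytingField)
open import Algebra.Bundles using (CommutativeRing)
open import Data.Empty using (⊥-elim)
open import Data.Fin.Base using (Fin)
open import Data.Fin.Patterns using (0F; 1F)
open import Data.Fin.Permutation using (Permutation; permutation; _⟨$⟩ʳ_)
open import Data.Fin.Properties using (_≟_)
open import Data.List.Base using ([]; _∷_)
open import Data.Nat.Base using (ℕ; zero; suc)
open import Data.Product.Base using (_×_; _,_; proj₁; proj₂)
open import Data.Sum.Base using (_⊎_; inj₁; inj₂; [_,_]′)
open import Function.Base using (_∘_)
open import Relation.Binary.PropositionalEquality.Core as ≡ using (_≡_)
open import Relation.Nullary.Decidable using (decidable-stable)
open import Relation.Nullary.Negation using (¬_)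
import Algebra.Properties.CommutativeMonoid.Sum as SumProperties
import Algebra.Properties.CommutativeSemigroup as CommutativeSemigroupProperties
import Algebra.Properties.Ring as RingProperties
import Algebra.Solver.Ring.NaturalCoefficients.Default as SemiringSolver
import Relation.Binary.Reasoning.Setoid as ≈-Reasoning

-- Fields with apartness: inverses, cancellation and sums.

module FieldProperties {c ℓ₁ ℓ₂} (K : HeytingField c ℓ₁ ℓ₂) where

  open Field K
  open Apartness K
  open CommutativeRing commutativeRing using (+-commutativeMonoid)
  open SumProperties +-commutativeMonoid using (sum-cong-≋; sum-permute)
  open ≈-Reasoning setoid

  ≈⇒¬# : ∀ {x y} → x ≈ y → ¬ x # y
  ≈⇒¬# {x} {y} = proj₂ (tight x y)

  -- The inverse of `x - y` that apartness supplies serves again: `invertibleʳ⇒#` asks for an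
  -- inverse of `(x - y) - 0#`, the same element up to `_≈_`.
  #⇒-#0 : ∀ {x y} → x # y → x - y # 0#
  #⇒-#0 {x} {y} x#y = invertibleʳ⇒# (proj₁ inverse , trans (*-congʳ (x-0≈x (x - y))) (proj₂ (proj₂ inverse)))
    where inverse = #⇒invertible x#y

  -#0⇒# : ∀ {x y} → x - y # 0# → x # y
  -#0⇒# {x} {y} x-y#0 = invertibleʳ⇒# (proj₁ inverse , trans (*-congʳ (sym (x-0≈x (x - y)))) (proj₂ (proj₂ inverse)))
    where inverse = #⇒invertible x-y#0

  inv-inverseʳ : ∀ {x} (x#0 : x # 0#) → x * inv x x#0 ≈ 1#
  inv-inverseʳ {x} x#0 = trans (*-congʳ (sym (x-0≈x x))) (proj₂ (proj₂ (#⇒invertible x#0)))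

  inv-inverseˡ : ∀ {x} (x#0 : x # 0#) → inv x x#0 * x ≈ 1#
  inv-inverseˡ {x} x#0 = trans (*-comm _ x) (inv-inverseʳ x#0)

  *-cancelʳ : ∀ {x y z} → z # 0# → x * z ≈ y * z → x ≈ y
  *-cancelʳ {x} {y} {z} z#0 xz≈yz = begin
    x                      ≈⟨ *-identityʳ x ⟨
    x * 1#                 ≈⟨ *-congˡ (inv-inverseʳ z#0) ⟨
    x * (z * inv z z#0)    ≈⟨ *-assoc x z _ ⟨
    x * z * inv z z#0      ≈⟨ *-congʳ xz≈yz ⟩
    y * z * inv z z#0      ≈⟨ *-assoc y z _ ⟩
    y * (z * inv z z#0)    ≈⟨ *-congˡ (inv-inverseʳ z#0) ⟩
    y * 1#                 ≈⟨ *-identityʳ y ⟩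
    y                      ∎

  xy≈0∧y#0⇒x≈0 : ∀ {x y} → x * y ≈ 0# → y # 0# → x ≈ 0#
  xy≈0∧y#0⇒x≈0 {x} {y} xy≈0 y#0 = *-cancelʳ y#0 (trans xy≈0 (sym (zeroˡ y)))

  ^-#0 : ∀ {x} → x # 0# → ∀ n → x ^ n # 0#
  ^-#0 x#0 zero    = 1#0
  ^-#0 x#0 (suc n) = x#0y#0→xy#0 x#0 (^-#0 x#0 n)

  ^-congˡ : ∀ {x y} n → x ≈ y → x ^ n ≈ y ^ n
  ^-congˡ zero    x≈y = refl
  ^-congˡ (suc n) x≈y = *-cong x≈y (^-congˡ n x≈y)

  sum-reindex : ∀ {m n} (s : Fin m → Carrier) (t : Fin n → Carrier) (π : Permutation m n) →
                (∀ i → s i ≈ t (π ⟨$⟩ʳ i)) → sum s ≈ sum t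
  sum-reindex s t π s≈t∘π = trans (sum-cong-≋ s≈t∘π) (sym (sum-permute t π))

-- Polynomials as coefficient lists: ring laws.

module PolynomialProperties {c ℓ₁ ℓ₂} (K : HeytingField c ℓ₁ ℓ₂) where

  open Field K
  open Polynomial K
  open CommutativeRing commutativeRing using (commutativeSemiring)
  open CommutativeSemigroupProperties +-commutativeSemigroup using (interchange; x∙yz≈y∙xz)
  open SemiringSolver commutativeSemiring using (solve; _:+_; _:*_; _:=_)
  open ≈-Reasoning setoid

  coeff-+ₚ : ∀ p q i → coeff (p +ₚ q) i ≈ coeff p i + coeff q i
  coeff-+ₚ []      q       i       = sym (+-identityˡ _)
  coeff-+ₚ (a ∷ p) []      i       = sym (+-identityʳ _)
  coeff-+ₚ (a ∷ p) (b ∷ q) zero    = refl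
  coeff-+ₚ (a ∷ p) (b ∷ q) (suc i) = coeff-+ₚ p q i

  coeff-·ₚ : ∀ a p i → coeff (a ·ₚ p) i ≈ a * coeff p i
  coeff-·ₚ a []      i       = sym (zeroʳ a)
  coeff-·ₚ a (b ∷ p) zero    = refl
  coeff-·ₚ a (b ∷ p) (suc i) = coeff-·ₚ a p i

  coeff-*ₚ : ∀ a p q i → coeff ((a ∷ p) *ₚ q) i ≈ a * coeff q i + coeff (0# ∷ (p *ₚ q)) i
  coeff-*ₚ a p q i = trans (coeff-+ₚ (a ·ₚ q) _ i) (+-congʳ (coeff-·ₚ a q i))

  ∷-cong : ∀ {a b} p q → a ≈ b → p ≋ q → a ∷ p ≋ b ∷ q
  ∷-cong p q a≈b p≋q zero    = a≈b
  ∷-cong p q a≈b p≋q (suc i) = p≋q i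

  *ₚ-congˡ : ∀ p q r → q ≋ r → p *ₚ q ≋ p *ₚ r
  *ₚ-congˡ []      q r q≋r i = refl
  *ₚ-congˡ (a ∷ p) q r q≋r i = begin
    coeff ((a ∷ p) *ₚ q) i                   ≈⟨ coeff-*ₚ a p q i ⟩
    a * coeff q i + coeff (0# ∷ (p *ₚ q)) i
      ≈⟨ +-cong (*-congˡ (q≋r i)) (∷-cong (p *ₚ q) (p *ₚ r) refl (*ₚ-congˡ p q r q≋r) i) ⟩
    a * coeff r i + coeff (0# ∷ (p *ₚ r)) i  ≈⟨ coeff-*ₚ a p r i ⟨
    coeff ((a ∷ p) *ₚ r) i                   ∎

  *ₚ-zeroʳ : ∀ p → p *ₚ [] ≋ []
  *ₚ-zeroʳ []      i       = refl
  *ₚ-zeroʳ (a ∷ p) zero    = refl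
  *ₚ-zeroʳ (a ∷ p) (suc i) = *ₚ-zeroʳ p i

  -- `_*ₚ_` recurses on its left factor only. This is the matching recursion p (b + X q) = b p + X
  -- (p q) on the right, which makes commutativity a single induction on the left factor.
  coeff-*ₚ-∷ʳ : ∀ p b q i → coeff (p *ₚ (b ∷ q)) i ≈ b * coeff p i + coeff (0# ∷ (p *ₚ q)) i
  coeff-*ₚ-∷ʳ []      b q zero    = sym (trans (+-identityʳ _) (zeroʳ b))
  coeff-*ₚ-∷ʳ []      b q (suc i) = sym (trans (+-identityʳ _) (zeroʳ b))
  coeff-*ₚ-∷ʳ (a ∷ p) b q zero    = +-congʳ (*-comm a b)
  coeff-*ₚ-∷ʳ (a ∷ p) b q (suc i) = begin
    coeff (a ·ₚ q +ₚ p *ₚ (b ∷ q)) i                              ≈⟨ coeff-+ₚ (a ·ₚ q) _ i ⟩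
    coeff (a ·ₚ q) i + coeff (p *ₚ (b ∷ q)) i                     ≈⟨ +-cong (coeff-·ₚ a q i) (coeff-*ₚ-∷ʳ p b q i) ⟩
    a * coeff q i + (b * coeff p i + coeff (0# ∷ (p *ₚ q)) i)     ≈⟨ x∙yz≈y∙xz _ _ _ ⟩
    b * coeff p i + (a * coeff q i + coeff (0# ∷ (p *ₚ q)) i)     ≈⟨ +-congˡ (coeff-*ₚ a p q i) ⟨
    b * coeff p i + coeff ((a ∷ p) *ₚ q) i                        ∎

  *ₚ-comm : ∀ p q → p *ₚ q ≋ q *ₚ p
  *ₚ-comm []      q i = sym (*ₚ-zeroʳ q i)
  *ₚ-comm (a ∷ p) q i = begin
    coeff ((a ∷ p) *ₚ q) i                   ≈⟨ coeff-*ₚ a p q i ⟩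
    a * coeff q i + coeff (0# ∷ (p *ₚ q)) i
      ≈⟨ +-congˡ (∷-cong (p *ₚ q) (q *ₚ p) refl (*ₚ-comm p q) i) ⟩
    a * coeff q i + coeff (0# ∷ (q *ₚ p)) i  ≈⟨ coeff-*ₚ-∷ʳ q a p i ⟨
    coeff (q *ₚ (a ∷ p)) i                   ∎

  *ₚ-congʳ : ∀ p q r → q ≋ r → q *ₚ p ≋ r *ₚ p
  *ₚ-congʳ p q r q≋r i = begin
    coeff (q *ₚ p) i  ≈⟨ *ₚ-comm q p i ⟩
    coeff (p *ₚ q) i  ≈⟨ *ₚ-congˡ p q r q≋r i ⟩
    coeff (p *ₚ r) i  ≈⟨ *ₚ-comm p r i ⟩
    coeff (r *ₚ p) i  ∎

  -- Together with `coeff-+ₚ-*ₚ` this gives linearity in the left factor, by which `*ₚ-assoc`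
  -- expands (a q + X (p q)) r.
  coeff-·ₚ-*ₚ : ∀ a p q i → coeff (a ·ₚ p *ₚ q) i ≈ a * coeff (p *ₚ q) i
  coeff-·ₚ-*ₚ a []      q i = sym (zeroʳ a)
  coeff-·ₚ-*ₚ a (b ∷ p) q i = begin
    coeff (a ·ₚ (b ∷ p) *ₚ q) i                           ≈⟨ coeff-*ₚ (a * b) (a ·ₚ p) q i ⟩
    a * b * coeff q i + coeff (0# ∷ (a ·ₚ p *ₚ q)) i      ≈⟨ +-cong (*-assoc a b _) (shift i) ⟩
    a * (b * coeff q i) + a * coeff (0# ∷ (p *ₚ q)) i     ≈⟨ distribˡ a _ _ ⟨
    a * (b * coeff q i + coeff (0# ∷ (p *ₚ q)) i)         ≈⟨ *-congˡ (coeff-*ₚ b p q i) ⟨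
    a * coeff ((b ∷ p) *ₚ q) i                            ∎
    where
    shift : ∀ i → coeff (0# ∷ (a ·ₚ p *ₚ q)) i ≈ a * coeff (0# ∷ (p *ₚ q)) i
    shift zero    = sym (zeroʳ a)
    shift (suc i) = coeff-·ₚ-*ₚ a p q i

  coeff-+ₚ-*ₚ : ∀ p q r i → coeff ((p +ₚ q) *ₚ r) i ≈ coeff (p *ₚ r) i + coeff (q *ₚ r) i
  coeff-+ₚ-*ₚ []      q       r i = sym (+-identityˡ _)
  coeff-+ₚ-*ₚ (a ∷ p) []      r i = sym (+-identityʳ _)
  coeff-+ₚ-*ₚ (a ∷ p) (b ∷ q) r i = begin
    coeff ((a + b ∷ (p +ₚ q)) *ₚ r) i                        ≈⟨ coeff-*ₚ (a + b) (p +ₚ q) r i ⟩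
    (a + b) * coeff r i + coeff (0# ∷ ((p +ₚ q) *ₚ r)) i     ≈⟨ +-cong (distribʳ _ a b) (shift i) ⟩
    (a * coeff r i + b * coeff r i) + (coeff (0# ∷ (p *ₚ r)) i + coeff (0# ∷ (q *ₚ r)) i)
      ≈⟨ interchange _ _ _ _ ⟩
    (a * coeff r i + coeff (0# ∷ (p *ₚ r)) i) + (b * coeff r i + coeff (0# ∷ (q *ₚ r)) i)
      ≈⟨ +-cong (coeff-*ₚ a p r i) (coeff-*ₚ b q r i) ⟨
    coeff ((a ∷ p) *ₚ r) i + coeff ((b ∷ q) *ₚ r) i          ∎
    where
    shift : ∀ i → coeff (0# ∷ ((p +ₚ q) *ₚ r)) i ≈ coeff (0# ∷ (p *ₚ r)) i + coeff (0# ∷ (q *ₚ r)) i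
    shift zero    = sym (+-identityʳ 0#)
    shift (suc i) = coeff-+ₚ-*ₚ p q r i

  *ₚ-assoc : ∀ p q r → (p *ₚ q) *ₚ r ≋ p *ₚ (q *ₚ r)
  *ₚ-assoc []      q r i = refl
  *ₚ-assoc (a ∷ p) q r i = begin
    coeff ((a ·ₚ q +ₚ (0# ∷ (p *ₚ q))) *ₚ r) i                    ≈⟨ coeff-+ₚ-*ₚ (a ·ₚ q) _ r i ⟩
    coeff (a ·ₚ q *ₚ r) i + coeff ((0# ∷ (p *ₚ q)) *ₚ r) i        ≈⟨ +-cong (coeff-·ₚ-*ₚ a q r i) (coeff-*ₚ 0# (p *ₚ q) r i) ⟩
    a * coeff (q *ₚ r) i + (0# * coeff r i + coeff (0# ∷ ((p *ₚ q) *ₚ r)) i)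
      ≈⟨ +-congˡ (trans (+-congʳ (zeroˡ _)) (+-identityˡ _)) ⟩
    a * coeff (q *ₚ r) i + coeff (0# ∷ ((p *ₚ q) *ₚ r)) i
      ≈⟨ +-congˡ (∷-cong ((p *ₚ q) *ₚ r) (p *ₚ (q *ₚ r)) refl (*ₚ-assoc p q r) i) ⟩
    a * coeff (q *ₚ r) i + coeff (0# ∷ (p *ₚ (q *ₚ r))) i         ≈⟨ coeff-*ₚ a p (q *ₚ r) i ⟨
    coeff ((a ∷ p) *ₚ (q *ₚ r)) i                                 ∎

  *ₚ-identityʳ : ∀ p → p *ₚ const 1# ≋ p
  *ₚ-identityʳ p i = begin
    coeff (p *ₚ const 1#) i                    ≈⟨ coeff-*ₚ-∷ʳ p 1# [] i ⟩
    1# * coeff p i + coeff (0# ∷ (p *ₚ [])) i  ≈⟨ +-cong (*-identityˡ _) (shift i) ⟩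
    coeff p i + 0#                             ≈⟨ +-identityʳ _ ⟩
    coeff p i                                  ∎
    where
    shift : ∀ i → coeff (0# ∷ (p *ₚ [])) i ≈ 0#
    shift zero    = refl
    shift (suc i) = *ₚ-zeroʳ p i

  -- Evaluation and differentiation at a point.

  eval-congʳ : ∀ p {x y} → x ≈ y → eval p x ≈ eval p y
  eval-congʳ []      x≈y = refl
  eval-congʳ (a ∷ p) x≈y = +-congˡ (*-cong x≈y (eval-congʳ p x≈y))

  module _ (x : Carrier) where

    eval-const : ∀ b → eval (const b) x ≈ b
    eval-const b = trans (+-congˡ (zeroʳ x)) (+-identityʳ b)

    -- `X +ₚ const b`, `X -ₚ const b` and `const 1# +ₚ X` reduce to lists of this shape, with
    -- constant terms `0# + b`, `0# - b` and `1# + 0#`.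
    eval-monicLinear : ∀ b → eval (b ∷ 1# ∷ []) x ≈ b + x
    eval-monicLinear b = +-congˡ (trans (*-congˡ (eval-const 1#)) (*-identityʳ x))

    eval-^ₚ : ∀ p n → eval (p ^ₚ n) x ≈ eval p x ^ n
    eval-^ₚ p zero    = eval-const 1#
    eval-^ₚ p (suc n) = trans (eval-*ₚ x p (p ^ₚ n)) (*-congˡ (eval-^ₚ p n))

    -- Lists related by `_≋_` may differ in length; the surplus entries are then zeros, and this
    -- disposes of them.
    eval-[] : ∀ p → p ≋ [] → eval p x ≈ 0#
    eval-[] []      p≋[] = refl
    eval-[] (a ∷ p) p≋[] = begin
      a + x * eval p x  ≈⟨ +-cong (p≋[] 0) (*-congˡ (eval-[] p (λ i → p≋[] (suc i)))) ⟩
      0# + x * 0#       ≈⟨ +-identityˡ _ ⟩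
      x * 0#            ≈⟨ zeroʳ x ⟩
      0#                ∎

    eval-cong : ∀ p q → p ≋ q → eval p x ≈ eval q x
    eval-cong []      q       p≋q = sym (eval-[] q (λ i → sym (p≋q i)))
    eval-cong (a ∷ p) []      p≋q = eval-[] (a ∷ p) p≋q
    eval-cong (a ∷ p) (b ∷ q) p≋q = +-cong (p≋q 0) (*-congˡ (eval-cong p q (λ i → p≋q (suc i))))

    -- Only values of derivatives enter the residue argument, so the rules of differentiation are
    -- proved after evaluation, as identities in the field.
    eval′ : Poly → Carrier
    eval′ p = eval (derivₚ p) x

    eval′-∷ : ∀ a p → eval′ (a ∷ p) ≈ eval p x + x * eval′ p
    eval′-∷ a p = trans (eval-+ₚ x p _) (+-congˡ (+-identityˡ _))

    eval′-[] : ∀ p → p ≋ [] → eval′ p ≈ 0#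
    eval′-[] []      p≋[] = refl
    eval′-[] (a ∷ p) p≋[] = begin
      eval′ (a ∷ p)          ≈⟨ eval′-∷ a p ⟩
      eval p x + x * eval′ p ≈⟨ +-cong (eval-[] p tail≋[]) (*-congˡ (eval′-[] p tail≋[])) ⟩
      0# + x * 0#            ≈⟨ +-identityˡ _ ⟩
      x * 0#                 ≈⟨ zeroʳ x ⟩
      0#                     ∎
      where
      tail≋[] : p ≋ []
      tail≋[] i = p≋[] (suc i)

    eval′-cong : ∀ p q → p ≋ q → eval′ p ≈ eval′ q
    eval′-cong []      q       p≋q = sym (eval′-[] q (λ i → sym (p≋q i)))
    eval′-cong (a ∷ p) []      p≋q = eval′-[] (a ∷ p) p≋q
    eval′-cong (a ∷ p) (b ∷ q) p≋q = begin
      eval′ (a ∷ p)           ≈⟨ eval′-∷ a p ⟩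
      eval p x + x * eval′ p  ≈⟨ +-cong (eval-cong p q tail≋) (*-congˡ (eval′-cong p q tail≋)) ⟩
      eval q x + x * eval′ q  ≈⟨ eval′-∷ b q ⟨
      eval′ (b ∷ q)           ∎
      where
      tail≋ : p ≋ q
      tail≋ i = p≋q (suc i)

    eval′-+ₚ : ∀ p q → eval′ (p +ₚ q) ≈ eval′ p + eval′ q
    eval′-+ₚ []      q       = sym (+-identityˡ _)
    eval′-+ₚ (a ∷ p) []      = sym (+-identityʳ _)
    eval′-+ₚ (a ∷ p) (b ∷ q) = begin
      eval′ (a + b ∷ (p +ₚ q))                                  ≈⟨ eval′-∷ (a + b) (p +ₚ q) ⟩
      eval (p +ₚ q) x + x * eval′ (p +ₚ q)                      ≈⟨ +-cong (eval-+ₚ x p q) (*-congˡ (eval′-+ₚ p q)) ⟩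
      (eval p x + eval q x) + x * (eval′ p + eval′ q)           ≈⟨ +-congˡ (distribˡ x _ _) ⟩
      (eval p x + eval q x) + (x * eval′ p + x * eval′ q)       ≈⟨ interchange _ _ _ _ ⟩
      (eval p x + x * eval′ p) + (eval q x + x * eval′ q)       ≈⟨ +-cong (eval′-∷ a p) (eval′-∷ b q) ⟨
      eval′ (a ∷ p) + eval′ (b ∷ q)                             ∎

    eval′-·ₚ : ∀ a p → eval′ (a ·ₚ p) ≈ a * eval′ p
    eval′-·ₚ a []      = sym (zeroʳ a)
    eval′-·ₚ a (b ∷ p) = begin
      eval′ (a * b ∷ a ·ₚ p)               ≈⟨ eval′-∷ (a * b) (a ·ₚ p) ⟩
      eval (a ·ₚ p) x + x * eval′ (a ·ₚ p) ≈⟨ +-cong (eval-·ₚ x a p) (*-congˡ (eval′-·ₚ a p)) ⟩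
      a * eval p x + x * (a * eval′ p)
        ≈⟨ solve 4 (λ a x e d → a :* e :+ x :* (a :* d) := a :* (e :+ x :* d)) refl a x _ _ ⟩
      a * (eval p x + x * eval′ p)         ≈⟨ *-congˡ (eval′-∷ b p) ⟨
      a * eval′ (b ∷ p)                    ∎

    eval′-*ₚ : ∀ p q → eval′ (p *ₚ q) ≈ eval′ p * eval q x + eval p x * eval′ q
    eval′-*ₚ []      q = sym (trans (+-cong (zeroˡ _) (zeroˡ _)) (+-identityˡ 0#))
    eval′-*ₚ (a ∷ p) q = begin
      eval′ (a ·ₚ q +ₚ (0# ∷ (p *ₚ q)))                 ≈⟨ eval′-+ₚ (a ·ₚ q) _ ⟩
      eval′ (a ·ₚ q) + eval′ (0# ∷ (p *ₚ q))            ≈⟨ +-cong (eval′-·ₚ a q) (eval′-∷ 0# (p *ₚ q)) ⟩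
      a * eval′ q + (eval (p *ₚ q) x + x * eval′ (p *ₚ q))
        ≈⟨ +-congˡ (+-cong (eval-*ₚ x p q) (*-congˡ (eval′-*ₚ p q))) ⟩
      a * eval′ q + (eval p x * eval q x + x * (eval′ p * eval q x + eval p x * eval′ q))
        ≈⟨ solve 6 (λ a x p p′ q q′ → a :* q′ :+ (p :* q :+ x :* (p′ :* q :+ p :* q′))
                                   := (p :+ x :* p′) :* q :+ (a :+ x :* p) :* q′)
                   refl a x _ _ _ _ ⟩
      (eval p x + x * eval′ p) * eval q x + (a + x * eval p x) * eval′ q
        ≈⟨ +-congʳ (*-congʳ (eval′-∷ a p)) ⟨
      eval′ (a ∷ p) * eval q x + eval (a ∷ p) x * eval′ q  ∎

    eval-root-*ₚ : ∀ p q → eval p x ≈ 0# → eval (p *ₚ q) x ≈ 0#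
    eval-root-*ₚ p q p[x]≈0 = trans (eval-*ₚ x p q) (trans (*-congʳ p[x]≈0) (zeroˡ _))

    -- The Leibniz term containing `eval p x` drops out, so that nothing about the derivative of `q`
    -- has to be known.
    eval′-root-*ₚ : ∀ p q → eval p x ≈ 0# → eval′ (p *ₚ q) ≈ eval′ p * eval q x
    eval′-root-*ₚ p q p[x]≈0 = begin
      eval′ (p *ₚ q)                            ≈⟨ eval′-*ₚ p q ⟩
      eval′ p * eval q x + eval p x * eval′ q   ≈⟨ +-congˡ (trans (*-congʳ p[x]≈0) (zeroˡ _)) ⟩
      eval′ p * eval q x + 0#                   ≈⟨ +-identityʳ _ ⟩
      eval′ p * eval q x                        ∎

    eval′-monicLinear : ∀ b → eval′ (b ∷ 1# ∷ []) ≈ 1#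
    eval′-monicLinear b = begin
      (1# + 0#) + x * (0# + x * 0#)  ≈⟨ +-cong (+-identityʳ 1#) (*-congˡ (eval-const 0#)) ⟩
      1# + x * 0#                    ≈⟨ +-congˡ (zeroʳ x) ⟩
      1# + 0#                        ≈⟨ +-identityʳ 1# ⟩
      1#                             ∎

-- Poles and residues of rational functions.

module ResidueProperties {c ℓ₁ ℓ₂} (K : HeytingField c ℓ₁ ℓ₂) (char0 : CharacteristicZero K) where

  open Field K
  open FieldProperties K
  open Polynomial K
  open PolynomialProperties K
  open Apartness K
  open Residue K char0
  open CommutativeRing commutativeRing using (commutativeSemiring)
  open RingProperties ring using (-‿distribʳ-*; -‿involutive)
  open SemiringSolver commutativeSemiring using (solve; _:*_; _:=_)
  open ≈-Reasoning setoid

  eval-X-const : ∀ a → eval (X -ₚ const a) a ≈ 0#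
  eval-X-const a = begin
    eval (X -ₚ const a) a  ≈⟨ eval-monicLinear a (0# - a) ⟩
    0# - a + a             ≈⟨ +-congʳ (+-identityˡ _) ⟩
    - a + a                ≈⟨ -‿inverseˡ a ⟩
    0#                     ∎

  num[a]#0 : ∀ {a} (g : RegularAt a) → value g # 0# → eval (RegularAt.num g) a # 0#
  num[a]#0 g = xy#0⇒x#0 {eval (RegularAt.num g) _} {inv _ (RegularAt.den[a]#0 g)}

  module _ {f : RationalFunction} {a : Carrier} where

    open RationalFunction f

    -- At `a` the left side of `g-spec` is zero, since the exponent `suc m` guarantees a factor X -
    -- a. The right side is then a zero product whose factor `g.num` is apart from zero there.
    pole⇒den[a]≈0 : PoleAt f a → eval den a ≈ 0#
    pole⇒den[a]≈0 p = xy≈0∧y#0⇒x≈0 (begin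
      eval den a * eval g.num a     ≈⟨ *-comm _ _ ⟩
      eval g.num a * eval den a     ≈⟨ eval-*ₚ a g.num den ⟨
      eval (g.num *ₚ den) a         ≈⟨ eval-cong a ((X-a *ₚ X-a ^ₚ m *ₚ num) *ₚ g.den) (g.num *ₚ den) g-spec ⟨
      eval ((X-a *ₚ X-a ^ₚ m *ₚ num) *ₚ g.den) a
        ≈⟨ eval-root-*ₚ a (X-a *ₚ X-a ^ₚ m *ₚ num) g.den
             (eval-root-*ₚ a (X-a *ₚ X-a ^ₚ m) num
               (eval-root-*ₚ a X-a (X-a ^ₚ m) (eval-X-const a))) ⟩
      0#                            ∎)
      (num[a]#0 g g[a]#0)
      where
      open PoleAt p
      module g = RegularAt g
      X-a = X -ₚ const a

    -- `g-spec` is differentiated at `a`. Every use of the Leibniz rule has a vanishing first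
    -- factor: `den` on one side, a product beginning with X - a on the other. The remaining power
    -- has exponent `m`, one less than the order, which separates simple poles from the others.
    pole-derivative : (p : PoleAt f a) →
                      eval (RegularAt.num (PoleAt.g p)) a * eval′ a den ≈
                      eval ((X -ₚ const a) ^ₚ PoleAt.m p) a * (eval num a * eval (RegularAt.den (PoleAt.g p)) a)
    pole-derivative p = begin
      eval g.num a * eval′ a den       ≈⟨ *-comm _ _ ⟩
      eval′ a den * eval g.num a       ≈⟨ eval′-root-*ₚ a den g.num (pole⇒den[a]≈0 p) ⟨
      eval′ a (den *ₚ g.num)           ≈⟨ eval′-cong a (den *ₚ g.num) (g.num *ₚ den) (*ₚ-comm den g.num) ⟩
      eval′ a (g.num *ₚ den)           ≈⟨ eval′-cong a ((X-a *ₚ X-a ^ₚ m *ₚ num) *ₚ g.den) (g.num *ₚ den) g-spec ⟨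
      eval′ a ((X-a *ₚ X-a ^ₚ m *ₚ num) *ₚ g.den)
        ≈⟨ eval′-root-*ₚ a (X-a *ₚ X-a ^ₚ m *ₚ num) g.den
             (eval-root-*ₚ a (X-a *ₚ X-a ^ₚ m) num root) ⟩
      eval′ a (X-a *ₚ X-a ^ₚ m *ₚ num) * eval g.den a
        ≈⟨ *-congʳ (eval′-root-*ₚ a (X-a *ₚ X-a ^ₚ m) num root) ⟩
      eval′ a (X-a *ₚ X-a ^ₚ m) * eval num a * eval g.den a
        ≈⟨ *-congʳ (*-congʳ (eval′-root-*ₚ a X-a (X-a ^ₚ m) (eval-X-const a))) ⟩
      eval′ a X-a * eval (X-a ^ₚ m) a * eval num a * eval g.den a
        ≈⟨ *-congʳ (*-congʳ (trans (*-congʳ (eval′-monicLinear a (0# - a))) (*-identityˡ _))) ⟩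
      eval (X-a ^ₚ m) a * eval num a * eval g.den a    ≈⟨ *-assoc _ _ _ ⟩
      eval (X-a ^ₚ m) a * (eval num a * eval g.den a)  ∎
      where
      open PoleAt p
      module g = RegularAt g
      X-a = X -ₚ const a
      root : eval (X-a *ₚ X-a ^ₚ m) a ≈ 0#
      root = eval-root-*ₚ a X-a (X-a ^ₚ m) (eval-X-const a)

    -- The derivative stays as a factor, so no inverse of it has to be chosen. The record `p` is
    -- arbitrary, its order included: order one gives the equation, and a higher order contradicts
    -- `g[a]#0`.
    residue-simple : (p : PoleAt f a) → eval′ a den # 0# → residue p * eval′ a den ≈ eval num a
    residue-simple p@record { m = zero ; g = g } den′#0 = begin
      inv (fromℕ 1) 1#₀ * (eval g.num a * h⁻¹) * eval′ a den
        ≈⟨ solve 4 (λ u n h d → u :* (n :* h) :* d := u :* (n :* d :* h)) refl _ _ _ _ ⟩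
      inv (fromℕ 1) 1#₀ * (eval g.num a * eval′ a den * h⁻¹)
        -- For `m = 0` the power of X - a is `const 1#`, so `pole-derivative` reads g(a) D′(a) =
        -- N(a) h(a).
        ≈⟨ *-cong inv1≈1 (*-congʳ (trans (pole-derivative p) (trans (*-congʳ (eval-const a 1#)) (*-identityˡ _)))) ⟩
      1# * (eval num a * eval g.den a * h⁻¹)   ≈⟨ *-identityˡ _ ⟩
      eval num a * eval g.den a * h⁻¹          ≈⟨ *-assoc _ _ _ ⟩
      eval num a * (eval g.den a * h⁻¹)        ≈⟨ *-congˡ (inv-inverseʳ g.den[a]#0) ⟩
      eval num a * 1#                          ≈⟨ *-identityʳ _ ⟩
      eval num a                               ∎
      where
      module g = RegularAt g
      h⁻¹ = inv (eval g.den a) g.den[a]#0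
      1#₀ = char0 1
      -- `fromℕ (0 !)` unfolds to `1# + 0#`, so 1/0! equals `1#` only up to a proof.
      inv1≈1 : inv (fromℕ 1) 1#₀ ≈ 1#
      inv1≈1 = begin
        inv (fromℕ 1) 1#₀                ≈⟨ *-identityʳ _ ⟨
        inv (fromℕ 1) 1#₀ * 1#           ≈⟨ *-congˡ (+-identityʳ 1#) ⟨
        inv (fromℕ 1) 1#₀ * fromℕ 1      ≈⟨ inv-inverseˡ 1#₀ ⟩
        1#                               ∎
    residue-simple p@record { m = suc m ; g = g ; g[a]#0 = g[a]#0 } den′#0 =
      -- For order at least two a factor X - a survives in `pole-derivative` and forces g(a) D′(a) =
      -- 0, although both factors are apart from zero.
      ⊥-elim (≈⇒¬# (begin
        eval (RegularAt.num g) a * eval′ a den  ≈⟨ pole-derivative p ⟩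
        eval (X-a *ₚ X-a ^ₚ m) a * _            ≈⟨ *-congʳ (eval-root-*ₚ a X-a (X-a ^ₚ m) (eval-X-const a)) ⟩
        0# * _                                  ≈⟨ zeroˡ _ ⟩
        0#                                      ∎)
        (x#0y#0→xy#0 (num[a]#0 g g[a]#0) den′#0))
      where X-a = X -ₚ const a

    -- Multiplying N / ((X - a) h) by X - a leaves the witness N / h; `m = 0` encodes order one.
    simplePole : ∀ h → den ≋ (X -ₚ const a) *ₚ h → eval num a # 0# → eval h a # 0# → PoleAt f a
    simplePole h den≋[X-a]h num[a]#0 h[a]#0 = record
      { m      = 0
      ; g      = record { num = num ; den = h ; den[a]#0 = h[a]#0 }
      ; g-spec = λ i → begin
          coeff ((X-a *ₚ const 1# *ₚ num) *ₚ h) i  ≈⟨ *ₚ-congʳ h (X-a *ₚ const 1# *ₚ num) (num *ₚ X-a) reorder i ⟩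
          coeff ((num *ₚ X-a) *ₚ h) i              ≈⟨ *ₚ-assoc num X-a h i ⟩
          coeff (num *ₚ (X-a *ₚ h)) i              ≈⟨ *ₚ-congˡ num den (X-a *ₚ h) den≋[X-a]h i ⟨
          coeff (num *ₚ den) i                     ∎
      ; g[a]#0 = x#0y#0→xy#0 num[a]#0 (inv#0 h[a]#0)
      }
      where
      X-a = X -ₚ const a
      reorder : X-a *ₚ const 1# *ₚ num ≋ num *ₚ X-a
      reorder i = begin
        coeff (X-a *ₚ const 1# *ₚ num) i  ≈⟨ *ₚ-congʳ num (X-a *ₚ const 1#) X-a (*ₚ-identityʳ X-a) i ⟩
        coeff (X-a *ₚ num) i              ≈⟨ *ₚ-comm X-a num i ⟩
        coeff (num *ₚ X-a) i              ∎

  module _ {f : RationalFunction} {a b : Carrier} where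

    open RationalFunction f

    -- The two records may choose different fractions `g`, and their points agree only up to `_≈_`.
    -- Both residues nevertheless satisfy the equation of `residue-simple`, in which the derivative
    -- can be cancelled.
    residue-cong : (p : PoleAt f a) (q : PoleAt f b) → eval′ a den # 0# → a ≈ b → residue p ≈ residue q
    residue-cong p q den′[a]#0 a≈b = *-cancelʳ den′[a]#0 (begin
      residue p * eval′ a den  ≈⟨ residue-simple p den′[a]#0 ⟩
      eval num a               ≈⟨ eval-congʳ num a≈b ⟩
      eval num b               ≈⟨ residue-simple q (#-congʳ den′[a]≈den′[b] den′[a]#0) ⟨
      residue q * eval′ b den  ≈⟨ *-congˡ den′[a]≈den′[b] ⟨
      residue q * eval′ a den  ∎)
      where
      den′[a]≈den′[b] : eval′ a den ≈ eval′ b den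
      den′[a]≈den′[b] = eval-congʳ (derivₚ den) a≈b

  module _ {f : RationalFunction} where

    open Poles

    -- Apartness of distinct poles only refutes `i ≢ j`; decidable equality on `Fin` removes the
    -- double negation.
    x-injective : (P : Poles f) → ∀ {i j} → x P i ≈ x P j → i ≡ j
    x-injective P {i} {j} xᵢ≈xⱼ = decidable-stable (i ≟ j) λ i≢j → ≈⇒¬# xᵢ≈xⱼ (distinct P i≢j)

    -- `complete` sends each pole of one listing to an index of the other with an equal point. A
    -- round trip returns to an equal point, hence by `x-injective` to the same index.
    polesPermutation : (P Q : Poles f) → Permutation (N P) (N Q)
    polesPermutation P Q = permutation (to P Q) (to Q P) (to-to P Q) (to-to Q P)
      where
      to : (P Q : Poles f) → Fin (N P) → Fin (N Q)
      to P Q i = proj₁ (complete Q (pole P i))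
      to-to : ∀ P Q j → to P Q (to Q P j) ≡ j
      to-to P Q j = x-injective Q (sym (trans (proj₂ (complete P (pole Q j)))
                                              (proj₂ (complete Q (pole P (to Q P j))))))

    -- `Res` is computed from a chosen listing of the poles. The condition on the derivative makes
    -- every pole simple, and then the choice does not matter.
    Res-unique : (∀ {a} → PoleAt f a → eval′ a (RationalFunction.den f) # 0#) →
                 (P Q : Poles f) → Res P ≈ Res Q
    Res-unique den′#0 P Q = sum-reindex (λ i → residue (pole P i)) (λ j → residue (pole Q j)) π λ i →
      residue-cong (pole P i) (pole Q (π ⟨$⟩ʳ i)) (den′#0 (pole P i)) (proj₂ (complete Q (pole P i)))
      where π = polesPermutation P Q

  module _ {f : RationalFunction} {a b : Carrier} (a#b : a # b)
           (den-roots : ∀ {x} → eval (RationalFunction.den f) x ≈ 0# → x ≈ a ⊎ x ≈ b)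
           (pole-a : PoleAt f a) (pole-b : PoleAt f b) where

    open RationalFunction f

    twoPoles : Poles f
    twoPoles = record
      { N        = 2
      ; x        = x
      ; pole     = λ { 0F → pole-a ; 1F → pole-b }
      ; distinct = λ { {0F} {0F} 0≢0 → ⊥-elim (0≢0 ≡.refl)
                     ; {0F} {1F} _   → a#b
                     ; {1F} {0F} _   → #-sym a#b
                     ; {1F} {1F} 1≢1 → ⊥-elim (1≢1 ≡.refl) }
      ; complete = λ p → [ (0F ,_) , (1F ,_) ]′ (den-roots (pole⇒den[a]≈0 p))
      }
      where
      x : Fin 2 → Carrier
      x 0F = a
      x 1F = b

    -- `Res-unique` exchanges an arbitrary listing for `twoPoles`. The derivatives of a monic
    -- quadratic at its two roots are opposite, whence the shape `- d` and `d` of the hypotheses and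
    -- the minus sign before `ν`.
    Res-twoPoles : ∀ {d ν μ} → d # 0# → eval′ a den ≈ - d → eval′ b den ≈ d →
                   eval num a ≈ ν → eval num b ≈ μ → (P : Poles f) → Res P * d ≈ μ - ν
    Res-twoPoles {d} {ν} {μ} d#0 den′[a]≈-d den′[b]≈d num[a]≈ν num[b]≈μ P = begin
      Res P * d                                ≈⟨ *-congʳ (Res-unique den′#0 P twoPoles) ⟩
      (rᵃ + (rᵇ + 0#)) * d                     ≈⟨ *-congʳ (+-congˡ (+-identityʳ rᵇ)) ⟩
      (rᵃ + rᵇ) * d                            ≈⟨ distribʳ d rᵃ rᵇ ⟩
      rᵃ * d + rᵇ * d                          ≈⟨ +-cong rᵃd≈-ν rᵇd≈μ ⟩
      - ν + μ                                  ≈⟨ +-comm (- ν) μ ⟩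
      μ - ν                                    ∎
      where
      rᵃ rᵇ : Carrier
      rᵃ = residue pole-a
      rᵇ = residue pole-b
      den′[a]#0 : eval′ a den # 0#
      den′[a]#0 = #-congʳ (trans (+-identityˡ _) (sym den′[a]≈-d)) (#⇒-#0 (#-sym d#0))
      den′[b]#0 : eval′ b den # 0#
      den′[b]#0 = #-congʳ (sym den′[b]≈d) d#0
      den′#0 : ∀ {x} → PoleAt f x → eval′ x den # 0#
      den′#0 p = [ (λ x≈a → #-congʳ (eval-congʳ (derivₚ den) (sym x≈a)) den′[a]#0)
                 , (λ x≈b → #-congʳ (eval-congʳ (derivₚ den) (sym x≈b)) den′[b]#0)
                 ]′ (den-roots (pole⇒den[a]≈0 p))
      rᵃd≈-ν : rᵃ * d ≈ - ν
      rᵃd≈-ν = begin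
        rᵃ * d                 ≈⟨ -‿involutive _ ⟨
        - - (rᵃ * d)           ≈⟨ -‿cong (-‿distribʳ-* rᵃ d) ⟩
        - (rᵃ * - d)           ≈⟨ -‿cong (*-congˡ den′[a]≈-d) ⟨
        - (rᵃ * eval′ a den)   ≈⟨ -‿cong (residue-simple pole-a den′[a]#0) ⟩
        - eval num a           ≈⟨ -‿cong num[a]≈ν ⟩
        - ν                    ∎
      rᵇd≈μ : rᵇ * d ≈ μ
      rᵇd≈μ = begin
        rᵇ * d                 ≈⟨ *-congˡ den′[b]≈d ⟨
        rᵇ * eval′ b den       ≈⟨ residue-simple pole-b den′[b]#0 ⟩
        eval num b             ≈⟨ num[b]≈μ ⟩
        μ                      ∎

-- The golden ratio and the two poles.

module GoldenProperties {c ℓ₁ ℓ₂} (K : HeytingField c ℓ₁ ℓ₂) (char0 : CharacteristicZero K)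
                        (√5 : HeytingField.Carrier K)
                        (√5²≈5 : HeytingField._≈_ K (HeytingField._*_ K √5 √5) (Field.fromℕ K 5)) where

  open Field K
  open FieldProperties K
  open Polynomial K
  open PolynomialProperties K
  open Apartness K
  open Residue K char0
  open ResidueProperties K char0
  open Golden K char0 √5 √5²≈5
  open CommutativeRing commutativeRing using (commutativeSemiring)
  open RingProperties ring
    using (-‿involutive; x≈z//y; x∙y⁻¹≈ε⇒x≈y; +-inverseˡ-unique; +-cancelʳ)
  open CommutativeSemigroupProperties *-commutativeSemigroup using (xy∙z≈xz∙y)
  open SemiringSolver commutativeSemiring using (solve; _:+_; _:*_; _:=_; con; Polynomial)
  open ≈-Reasoning setoid

  -- Denotes fromℕ n definitionally; con n denotes the sum without the final + 0#.
  numeral : ∀ {k} → ℕ → Polynomial k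
  numeral zero    = con 0
  numeral (suc n) = con 1 :+ numeral n

  φ+φ≈1+√5 : φ + φ ≈ 1# + √5
  φ+φ≈1+√5 = begin
    φ + φ                     ≈⟨ solve 1 (λ x → x :+ x := numeral 2 :* x) refl φ ⟩
    fromℕ 2 * (½ * (1# + √5)) ≈⟨ *-assoc _ _ _ ⟨
    fromℕ 2 * ½ * (1# + √5)   ≈⟨ *-congʳ (inv-inverseʳ (char0 2)) ⟩
    1# * (1# + √5)            ≈⟨ *-identityˡ _ ⟩
    1# + √5                   ∎

  -- The factor 4 = 2 · 2 turns φ² into (φ + φ)², so that `½` need not be expanded.
  φ²≈φ+1 : φ * φ ≈ φ + 1#
  φ²≈φ+1 = *-cancelʳ (char0 4) (begin
    φ * φ * fromℕ 4                   ≈⟨ solve 1 (λ x → x :* x :* numeral 4 := (x :+ x) :* (x :+ x)) refl φ ⟩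
    (φ + φ) * (φ + φ)                 ≈⟨ *-cong φ+φ≈1+√5 φ+φ≈1+√5 ⟩
    (1# + √5) * (1# + √5)
      ≈⟨ solve 1 (λ s → (con 1 :+ s) :* (con 1 :+ s) := con 1 :+ s :+ s :+ s :* s) refl √5 ⟩
    1# + √5 + √5 + √5 * √5            ≈⟨ +-congˡ √5²≈5 ⟩
    1# + √5 + √5 + fromℕ 5
      ≈⟨ solve 1 (λ s → con 1 :+ s :+ s :+ numeral 5 := numeral 2 :* (con 1 :+ s) :+ numeral 4) refl √5 ⟩
    fromℕ 2 * (1# + √5) + fromℕ 4     ≈⟨ +-congʳ (*-congˡ φ+φ≈1+√5) ⟨
    fromℕ 2 * (φ + φ) + fromℕ 4
      ≈⟨ solve 1 (λ x → numeral 2 :* (x :+ x) :+ numeral 4 := (x :+ con 1) :* numeral 4) refl φ ⟩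
    (φ + 1#) * fromℕ 4                ∎)

  1/φ+1≈φ : 1/φ + 1# ≈ φ
  1/φ+1≈φ = *-cancelʳ φ#0 (begin
    (1/φ + 1#) * φ     ≈⟨ distribʳ φ 1/φ 1# ⟩
    1/φ * φ + 1# * φ   ≈⟨ +-cong (inv-inverseˡ φ#0) (*-identityˡ φ) ⟩
    1# + φ             ≈⟨ +-comm 1# φ ⟩
    φ + 1#             ≈⟨ φ²≈φ+1 ⟨
    φ * φ              ∎)

  -- This is the difference of the poles `1/φ` and `- φ`, hence up to sign the derivative of the
  -- denominator at each. Adding `1#` reduces it to `φ + φ`.
  1/φ+φ≈√5 : 1/φ + φ ≈ √5
  1/φ+φ≈√5 = +-cancelʳ 1# _ _ (begin
    1/φ + φ + 1#     ≈⟨ solve 3 (λ x y z → x :+ y :+ z := x :+ z :+ y) refl 1/φ φ 1# ⟩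
    1/φ + 1# + φ     ≈⟨ +-congʳ 1/φ+1≈φ ⟩
    φ + φ            ≈⟨ φ+φ≈1+√5 ⟩
    1# + √5          ≈⟨ +-comm 1# √5 ⟩
    √5 + 1#          ∎)

  -- `1# - φ` is the negative of `1/φ`. It is also the value of 1 + x at `- φ`, so the numerator
  -- cannot cancel that pole.
  1-φ#0 : 1# - φ # 0#
  1-φ#0 = #⇒-#0 (#-sym (-#0⇒# (#-congʳ (x≈z//y 1/φ 1# φ 1/φ+1≈φ) (inv#0 φ#0))))

  -√5#0 : - √5 # 0#
  -√5#0 = #-congʳ (+-identityˡ _) (#⇒-#0 (#-sym √5#0))

  -φ#1/φ : - φ # 1/φ
  -φ#1/φ = #-sym (-#0⇒# (#-congʳ (sym (trans (+-congˡ (-‿involutive φ)) 1/φ+φ≈√5)) √5#0))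

  -- The function (1 + x)ⁿ / ((x + φ) (x - 1/φ)).

  module _ (n : ℕ) where

    open RationalFunction (f n) using (num; den)

    num[_] : ∀ a → eval num a ≈ (1# + a) ^ n
    num[ a ] = trans (eval-^ₚ a (const 1# +ₚ X) n)
      (^-congˡ n (trans (eval-monicLinear a (1# + 0#)) (+-congʳ (+-identityʳ 1#))))

    num[-φ] : eval num (- φ) ≈ (1# - φ) ^ n
    num[-φ] = num[ - φ ]

    num[1/φ] : eval num 1/φ ≈ φ ^ n
    num[1/φ] = trans num[ 1/φ ] (^-congˡ n (trans (+-comm 1# 1/φ) 1/φ+1≈φ))

    eval-X+φ : ∀ a → eval (X +ₚ const φ) a ≈ a + φ
    eval-X+φ a = trans (eval-monicLinear a (0# + φ)) (trans (+-congʳ (+-identityˡ φ)) (+-comm φ a))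

    eval-X-1/φ : ∀ a → eval (X -ₚ const 1/φ) a ≈ a - 1/φ
    eval-X-1/φ a = trans (eval-monicLinear a (0# - 1/φ)) (trans (+-congʳ (+-identityˡ _)) (+-comm _ a))

    den[_] : ∀ a → eval den a ≈ (a + φ) * (a - 1/φ)
    den[ a ] = trans (eval-*ₚ a (X +ₚ const φ) (X -ₚ const 1/φ)) (*-cong (eval-X+φ a) (eval-X-1/φ a))

    den′[_] : ∀ a → eval′ a den ≈ (a - 1/φ) + (a + φ)
    den′[ a ] = begin
      eval′ a den                                              ≈⟨ eval′-*ₚ a X+φ X-1/φ ⟩
      eval′ a X+φ * eval X-1/φ a + eval X+φ a * eval′ a X-1/φ
        ≈⟨ +-cong (*-cong (eval′-monicLinear a (0# + φ)) (eval-X-1/φ a))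
                  (*-cong (eval-X+φ a) (eval′-monicLinear a (0# - 1/φ))) ⟩
      1# * (a - 1/φ) + (a + φ) * 1#                            ≈⟨ +-cong (*-identityˡ _) (*-identityʳ _) ⟩
      (a - 1/φ) + (a + φ)                                      ∎
      where
      X+φ = X +ₚ const φ
      X-1/φ = X -ₚ const 1/φ

    den′[-φ] : eval′ (- φ) den ≈ - √5
    den′[-φ] = trans den′[ - φ ] (+-inverseˡ-unique _ √5 (begin
      (- φ - 1/φ) + (- φ + φ) + √5           ≈⟨ +-congʳ (+-congˡ (-‿inverseˡ φ)) ⟩
      (- φ - 1/φ) + 0# + √5                  ≈⟨ +-cong (+-identityʳ _) (sym 1/φ+φ≈√5) ⟩
      (- φ - 1/φ) + (1/φ + φ)
        -- The semiring solver has no subtraction, so each negative is passed as a variable of its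
        -- own.
        ≈⟨ solve 4 (λ x x⁻ y y⁻ → (x⁻ :+ y⁻) :+ (y :+ x) := (x⁻ :+ x) :+ (y⁻ :+ y)) refl φ (- φ) 1/φ (- 1/φ) ⟩
      (- φ + φ) + (- 1/φ + 1/φ)              ≈⟨ +-cong (-‿inverseˡ φ) (-‿inverseˡ 1/φ) ⟩
      0# + 0#                                ≈⟨ +-identityˡ 0# ⟩
      0#                                     ∎))

    den′[1/φ] : eval′ 1/φ den ≈ √5
    den′[1/φ] = begin
      eval′ 1/φ den              ≈⟨ den′[ 1/φ ] ⟩
      (1/φ - 1/φ) + (1/φ + φ)    ≈⟨ +-cong (-‿inverseʳ 1/φ) 1/φ+φ≈√5 ⟩
      0# + √5                    ≈⟨ +-identityˡ √5 ⟩
      √5                         ∎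

    -- A vanishing product does not by itself tell which factor vanishes. Since `- φ # 1/φ`,
    -- cotransitivity makes `a` apart from one of the two points; the corresponding factor can be
    -- cancelled, and the other is zero.
    den-roots : ∀ {a} → eval den a ≈ 0# → a ≈ - φ ⊎ a ≈ 1/φ
    den-roots {a} den[a]≈0 = [ inj₂ ∘ ≈1/φ , inj₁ ∘ ≈-φ ]′ (#-cotrans -φ#1/φ a)
      where
      factors≈0 : (a + φ) * (a - 1/φ) ≈ 0#
      factors≈0 = trans (sym den[ a ]) den[a]≈0
      ≈1/φ : - φ # a → a ≈ 1/φ
      ≈1/φ -φ#a = x∙y⁻¹≈ε⇒x≈y a 1/φ (xy≈0∧y#0⇒x≈0 {a - 1/φ} {a + φ}
        (trans (*-comm (a - 1/φ) (a + φ)) factors≈0)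
        (#-congʳ {a - - φ} {a + φ} (+-congˡ (-‿involutive φ)) (#⇒-#0 {a} { - φ} (#-sym -φ#a))))
      ≈-φ : a # 1/φ → a ≈ - φ
      ≈-φ a#1/φ = +-inverseˡ-unique a φ (xy≈0∧y#0⇒x≈0 {a + φ} {a - 1/φ} factors≈0 (#⇒-#0 a#1/φ))

    pole[-φ] : PoleAt (f n) (- φ)
    pole[-φ] = simplePole (X -ₚ const 1/φ)
      -- `simplePole` wants the factor as X - a with a = `- φ`; the constant terms `0# + φ` and
      -- `0# - (- φ)` differ by a double negation.
      (*ₚ-congʳ (X -ₚ const 1/φ) (X +ₚ const φ) (X -ₚ const (- φ))
        (∷-cong (1# ∷ []) (1# ∷ []) (+-congˡ (sym (-‿involutive φ))) (λ _ → refl)))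
      (#-congʳ (sym num[-φ]) (^-#0 1-φ#0 n))
      (#-congʳ (sym (eval-X-1/φ (- φ))) (#⇒-#0 -φ#1/φ))

    pole[1/φ] : PoleAt (f n) 1/φ
    pole[1/φ] = simplePole (X +ₚ const φ)
      (*ₚ-comm (X +ₚ const φ) (X -ₚ const 1/φ))
      (#-congʳ (sym num[1/φ]) (^-#0 φ#0 n))
      (#-congʳ (sym (trans (eval-X+φ 1/φ) 1/φ+φ≈√5)) √5#0)

    goldenPoles : Poles (f n)
    goldenPoles = twoPoles -φ#1/φ den-roots pole[-φ] pole[1/φ]

    -- Multiplication by `√5` clears both the factor 1/√5 of Binet's formula and the denominators of
    -- the residues. With `- φ` as first pole and `1/φ` as second, `Res-twoPoles` yields the powers
    -- in Binet's order.
    F≈Res : (P : Poles (f n)) → F n ≈ Res P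
    F≈Res P = *-cancelʳ √5#0 (trans F*√5≈binet (sym
      (Res-twoPoles -φ#1/φ den-roots pole[-φ] pole[1/φ] √5#0 den′[-φ] den′[1/φ] num[-φ] num[1/φ] P)))
      where
      F*√5≈binet : F n * √5 ≈ φ ^ n - (1# - φ) ^ n
      F*√5≈binet = begin
        inv √5 √5#0 * binet * √5    ≈⟨ xy∙z≈xz∙y (inv √5 √5#0) binet √5 ⟩
        inv √5 √5#0 * √5 * binet    ≈⟨ *-congʳ (inv-inverseˡ √5#0) ⟩
        1# * binet                  ≈⟨ *-identityˡ binet ⟩
        binet                       ∎
        where binet = φ ^ n - (1# - φ) ^ n

-- The first component provides a complete listing of the poles, so the claim about all listings is
-- not vacuous.
theorem2p1 :
    ∀ {c ℓ₁ ℓ₂} (K : HeytingField c ℓ₁ ℓ₂) (char0 : CharacteristicZero K) →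
    let open Field K in
    (√5 : Carrier) (√5²≈5 : √5 * √5 ≈ fromℕ 5) (n : ℕ) →
    let open Residue K char0
        open Golden K char0 √5 √5²≈5
    in
    Poles (f n) × ((P : Poles (f n)) → F n ≈ Res P)
theorem2p1 K char0 √5 √5²≈5 n = goldenPoles n , F≈Res n
  where open GoldenProperties K char0 √5 √5²≈5
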